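{- There are infinitely many connected graphs $G$ for which $\delta(G)=2$, $\Delta(G)=5$, and the inequality $$\frac{M_1(G)}{n(G)}>\frac{M_2(G)}{m(G)}$$ holds.
   Context: All graphs are finite, simple, non-null and have no isolated vertices. For a graph $G$ with vertex set $V(G)$ and edge set $E(G)$: $n(G)=|V(G)|$ is the order, $m(G)=|E(G)|$ is the size, $d_G(u)$ is the degree of a vertex $u$, and $\Delta(G)$ and $\delta(G)$ are the maximum and minimum degrees. The first and second Zagreb indices are $M_1(G)=\sum_{v\in V(G)}d_G(v)^2$ and $M_2(G)=\sum_{uv\in E(G)}d_G(u)d_G(v)$. "Infinitely many" is understood up to isomorphism. -}

module Defs where

open import Level using (0ℓ)
open import Data.Nat.Base as ℕ using (ℕ; NonZero; _*_; _^_)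
import Data.Nat.Properties as ℕ
open import Data.Nat.ListAction using (sum)
open import Data.Fin.Base as Fin using (Fin)
import Data.Fin.Properties as Fin
open import Data.Integer.Base using (+_)
open import Data.Rational.Base using (ℚ; _/_)
open import Data.List.Base using (List; length; filter; map; allFin; cartesianProduct)
open import Data.List.Extrema.Nat using (max; min)
open import Data.List.Membership.Propositional using (_∈_)
open import Data.List.Membership.Propositional.Properties
  using (∈-filter⁺; ∈-cartesianProduct⁺; ∈-allFin)
open import Data.List.Relation.Unary.Any using (here; there)
open import Data.Product.Base using (Σ-syntax; ∃-syntax; _×_; _,_)
open import Function.Bundles using (_↔_; _⇔_; module Inverse)
open import Relation.Binary.Core using (Rel)
open import Relation.Binary.Definitions
  using (Decidable; Symmetric; Irreflexive; tri<; tri≈; tri>)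
open import Relation.Binary.Construct.Closure.ReflexiveTransitive using (Star)
open import Relation.Binary.PropositionalEquality using (_≡_)
open import Relation.Nullary.Decidable using (_×-dec_)
open import Relation.Nullary.Negation using (contradiction)
open import Relation.Unary using (Pred)
import Relation.Unary as Unary

-- Finite simple non-null graphs without isolated vertices; the vertices are
-- labelled, and _≅_ below forgets the labelling.
record Graph : Set₁ where
  field
    order       : ℕ
    Adj         : Rel (Fin order) 0ℓ
    adj?        : Decidable Adj
    adj-sym     : Symmetric Adj
    adj-irrefl  : Irreflexive _≡_ Adj
    non-null    : NonZero order
    no-isolated : ∀ u → ∃[ v ] Adj u v

  Vertex : Set
  Vertex = Fin order

  vertices : List Vertex
  vertices = allFin order

  -- Each edge uv is listed exactly once, as the pair with u < v.
  IsEdge : Pred (Vertex × Vertex) 0ℓ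
  IsEdge (u , v) = u Fin.< v × Adj u v

  isEdge? : Unary.Decidable IsEdge
  isEdge? (u , v) = (u Fin.<? v) ×-dec adj? u v

  edges : List (Vertex × Vertex)
  edges = filter isEdge? (cartesianProduct vertices vertices)

  size : ℕ
  size = length edges

  degree : Vertex → ℕ
  degree u = length (filter (adj? u) vertices)

  Δ : ℕ
  Δ = max 0 (map degree vertices)

  -- The starting value `order` exceeds every degree and there is at least one
  -- vertex, so it is never the minimum.
  δ : ℕ
  δ = min order (map degree vertices)

  M₁ : ℕ
  M₁ = sum (map (λ v → degree v ^ 2) vertices)

  M₂ : ℕ
  M₂ = sum (map (λ (u , v) → degree u * degree v) edges)

  Connected : Set
  Connected = ∀ u v → Star Adj u v

  private
    nonEmpty : ∀ {A : Set} {x : A} {xs} → x ∈ xs → NonZero (length xs)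
    nonEmpty (here _)  = _
    nonEmpty (there _) = _

    ∈-edges : ∀ {u v} → u Fin.< v → Adj u v → (u , v) ∈ edges
    ∈-edges u<v a =
      ∈-filter⁺ isEdge? (∈-cartesianProduct⁺ (∈-allFin _) (∈-allFin _)) (u<v , a)

  size-nonZero : NonZero size
  size-nonZero with vertex₀ ← Fin.fromℕ< (ℕ.>-nonZero⁻¹ order {{non-null}})
               with v , a ← no-isolated vertex₀
               with Fin.<-cmp vertex₀ v
  ... | tri< u<v _ _ = nonEmpty (∈-edges u<v a)
  ... | tri≈ _ u≡v _ = contradiction a (adj-irrefl u≡v)
  ... | tri> _ _ v<u = nonEmpty (∈-edges v<u (adj-sym a))

  M₁/n : ℚ
  M₁/n = _/_ (+ M₁) order {{non-null}}

  M₂/m : ℚ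
  M₂/m = _/_ (+ M₂) size {{size-nonZero}}

open Graph

record _≅_ (G H : Graph) : Set where
  field
    bijection : Vertex G ↔ Vertex H
  open Inverse bijection using (to)
  field
    adjacency : ∀ u v → Adj G u v ⇔ Adj H (to u) (to v)

-- Infinitely many up to isomorphism: ℕ injects into the isomorphism classes.
-- There are no quotients, so injectivity is stated with _≅_ as the equality.
InfinitelyMany : Pred Graph 0ℓ → Set₁
InfinitelyMany P =
  Σ[ G ∈ (ℕ → Graph) ] (∀ i → P (G i)) × (∀ i j → G i ≅ G j → i ≡ j)

{-# OPTIONS --safe #-}

-- With mᵢⱼ the number of edges joining degrees i and j, the difference
-- M₂/m − M₁/n is a positive multiple of a sum over pairs of edges, in which the
-- pair of types (i , j), (k , l) contributes (ij − kl)(1/k + 1/l − 1/i − 1/j).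
-- This is negative for the types (2 , 5) and (3 , 3), as 2·5 > 3·3 and
-- 1/3 + 1/3 < 1/2 + 1/5. So take a fixed bipartite graph with 55 edges of type
-- (2 , 5) and hang on it a chain of k diamonds (K₄ minus an edge), all of whose
-- edges but three have type (3 , 3). Then n = 39 + 4k, m = 55 + 6k,
-- M₁ = 382 + 36k and M₂ = 541 + 54k, whence M₁ m − M₂ n = 2k − 89.
module Submission where

open import Defs
open import Data.Bool.Base using (true; false; if_then_else_; _∧_)
open import Data.Empty using (⊥)
open import Data.Fin as Fin using (Fin; zero; suc; _↑ʳ_; #_)
open import Data.Fin.Patterns using (0F; 1F; 2F; 3F)
import Data.Fin.Permutation as Perm
import Data.Fin.Properties as Fin
import Data.Integer.Base as ℤ
import Data.Integer.Properties as ℤ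
open import Data.List.Base as List using (List; []; _∷_; _++_; allFin; cartesianProduct; filter; map)
import Data.List.Properties as List
import Data.List.Extrema.Nat as Extrema
open import Data.List.Membership.Propositional using (_∈_; lose)
open import Data.List.Membership.Propositional.Properties using (∈-map⁺; ∈-allFin)
open import Data.List.NonEmpty.Base using (List⁺; _∷_; [_]; toList)
import Data.List.Relation.Unary.All.Properties as All
open import Data.List.Relation.Unary.Any using (any?; here)
open import Data.Nat.Base hiding (_>_)
open import Data.Nat.DivMod using (_mod_; _%_)
open import Data.Nat.ListAction using () renaming (sum to sumᴸ)
open import Data.Nat.ListAction.Properties using (sum-++)
open import Data.Nat.Properties
open import Data.Nat.Tactic.RingSolver using (solve-∀)
open import Algebra.Properties.CommutativeMonoid.Sum +-0-commutativeMonoid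
  using (sum; sum-cong-≗; sum-replicate-zero)
open import Data.Product.Base using (_×_; _,_; ∃-syntax; proj₁; proj₂)
open import Data.Rational.Base as ℚ using (_>_)
import Data.Rational.Properties as ℚ
open import Data.Rational.Unnormalised.Base as ℚᵘ using (mkℚᵘ)
import Data.Rational.Unnormalised.Properties as ℚᵘ
open import Data.Sum.Base using (inj₂)
open import Function.Base using (_∘_; id)
open import Level using (0ℓ)
open import Relation.Binary.Construct.Closure.ReflexiveTransitive using (Star; ε; _◅_; _◅◅_; gmap)
open import Relation.Binary.Core using (Rel)
open import Relation.Binary.Definitions using (Decidable; Symmetric; Irreflexive)
open import Relation.Binary.PropositionalEquality hiding ([_])
open import Relation.Nullary.Decidable using (Dec; does; no; from-yes; _×-dec_)
open import Relation.Unary using (Pred)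
import Relation.Unary as Unary

private
  variable
    A B : Set
    n : ℕ

-- Fractions, and sums and extrema over lists

/-mono-< : ∀ a b c d .{{_ : NonZero b}} .{{_ : NonZero d}} →
           a * d < c * b → ℤ.+ a ℚ./ b ℚ.< ℤ.+ c ℚ./ d
-- `ℚ._/_` reduces to lowest terms; for unnormalised fractions the order is the cross-multiplied
-- inequality itself.
/-mono-< a b@(suc b-1) c d@(suc d-1) ad<cb = ℚ.toℚᵘ-cancel-<
  (ℚᵘ.<-respˡ-≃ (ℚᵘ.≃-sym (ℚ.toℚᵘ-fromℚᵘ (mkℚᵘ (ℤ.+ a) b-1)))
  (ℚᵘ.<-respʳ-≃ (ℚᵘ.≃-sym (ℚ.toℚᵘ-fromℚᵘ (mkℚᵘ (ℤ.+ c) d-1)))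
  (ℚᵘ.*<* (subst₂ ℤ._<_ (ℤ.pos-* a d) (ℤ.pos-* c b) (ℤ.+<+ ad<cb)))))

sum-allFin : (f : Fin n → ℕ) → sumᴸ (map f (allFin n)) ≡ sum f
sum-allFin {n} f = trans (cong sumᴸ (List.map-tabulate id f)) (go n f)
  where
  go : ∀ n (f : Fin n → ℕ) → sumᴸ (List.tabulate f) ≡ sum f
  go zero    f = refl
  go (suc n) f = cong (f zero +_) (go n (f ∘ suc))

sum-filter : {P : Pred A 0ℓ} (P? : Unary.Decidable P) (f : A → ℕ) (xs : List A) →
             sumᴸ (map f (filter P? xs)) ≡ sumᴸ (map (λ x → if does (P? x) then f x else 0) xs)
sum-filter P? f []       = refl
sum-filter P? f (x ∷ xs) with does (P? x)
... | true  = cong (f x +_) (sum-filter P? f xs)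
... | false = sum-filter P? f xs

sum-cartesianProduct : (f : A × B → ℕ) (xs : List A) (ys : List B) →
  sumᴸ (map f (cartesianProduct xs ys)) ≡ sumᴸ (map (λ x → sumᴸ (map (λ y → f (x , y)) ys)) xs)
sum-cartesianProduct f []       ys = refl
sum-cartesianProduct f (x ∷ xs) ys = begin
  sumᴸ (map f (map (x ,_) ys ++ rest))
    ≡⟨ cong sumᴸ (List.map-++ f (map (x ,_) ys) rest) ⟩
  sumᴸ (map f (map (x ,_) ys) ++ map f rest)
    ≡⟨ sum-++ (map f (map (x ,_) ys)) (map f rest) ⟩
  sumᴸ (map f (map (x ,_) ys)) + sumᴸ (map f rest)
    ≡⟨ cong₂ _+_ (cong sumᴸ (sym (List.map-∘ ys))) (sum-cartesianProduct f xs ys) ⟩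
  _ ∎
  where
  open ≡-Reasoning
  rest = cartesianProduct xs ys

length≡sum : (xs : List A) → List.length xs ≡ sumᴸ (map (λ _ → 1) xs)
length≡sum []       = refl
length≡sum (x ∷ xs) = cong suc (length≡sum xs)

min-allFin : (f : Fin n → ℕ) {a top : ℕ} → a ≤ top → (∀ v → a ≤ f v) →
             ∀ v → f v ≡ a → Extrema.min top (map f (allFin n)) ≡ a
min-allFin f {a} {top} a≤top a≤f v fv≡a = ≤-antisym
  (Extrema.min≤v⁺ top (map f (allFin _)) (inj₂ (lose (∈-map⁺ f (∈-allFin v)) (≤-reflexive fv≡a))))
  (Extrema.v≤min⁺ {xs = map f (allFin _)} a≤top
    (All.map⁺ {f = f} (All.tabulate⁺ {f = id} a≤f)))

max-allFin : (f : Fin n → ℕ) {b : ℕ} → (∀ v → f v ≤ b) →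
             ∀ v → f v ≡ b → Extrema.max 0 (map f (allFin n)) ≡ b
max-allFin f {b} f≤b v fv≡b = ≤-antisym
  (Extrema.max≤v⁺ {xs = map f (allFin _)} z≤n
    (All.map⁺ {f = f} (All.tabulate⁺ {f = id} f≤b)))
  (Extrema.v≤max⁺ 0 (map f (allFin _)) (inj₂ (lose (∈-map⁺ f (∈-allFin v)) (≤-reflexive (sym fv≡b)))))

-- Connected graphs built one vertex at a time

-- r ◂ g adds to g a new vertex zero, adjacent to the vertices listed in r.
-- Since r is nonempty, codes describe connected graphs only.
infixr 5 _◂_
data Code : ℕ → Set where
  •   : Code 1
  _◂_ : List⁺ (Fin n) → Code n → Code (suc n)

_∈⁺?_ : (v : Fin n) (r : List⁺ (Fin n)) → Dec (v ∈ toList r)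
v ∈⁺? r = any? (v Fin.≟_) (toList r)

Adj : Code n → Rel (Fin n) 0ℓ
Adj •       _       _       = ⊥
Adj (r ◂ g) zero    zero    = ⊥
Adj (r ◂ g) zero    (suc v) = v ∈ toList r
Adj (r ◂ g) (suc u) zero    = u ∈ toList r
Adj (r ◂ g) (suc u) (suc v) = Adj g u v

adj? : (g : Code n) → Decidable (Adj g)
adj? •       _       _       = no λ ()
adj? (r ◂ g) zero    zero    = no λ ()
adj? (r ◂ g) zero    (suc v) = v ∈⁺? r
adj? (r ◂ g) (suc u) zero    = u ∈⁺? r
adj? (r ◂ g) (suc u) (suc v) = adj? g u v

adj-sym : (g : Code n) → Symmetric (Adj g)
adj-sym (r ◂ g) {zero}  {suc v} a = a
adj-sym (r ◂ g) {suc u} {zero}  a = a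
adj-sym (r ◂ g) {suc u} {suc v} a = adj-sym g a

adj-irrefl : (g : Code n) → Irreflexive _≡_ (Adj g)
adj-irrefl (r ◂ g) {suc u} refl a = adj-irrefl g refl a

-- An old vertex keeps the neighbour it has in `g`, unless `g` is `•`; then the nonempty `r` must
-- list its only vertex.
neighbour : (r : List⁺ (Fin n)) (g : Code n) → ∀ u → ∃[ v ] Adj (r ◂ g) u v
neighbour (v ∷ _)    _       zero       = suc v , here refl
neighbour (zero ∷ _) •       (suc zero) = zero , here refl
neighbour _          (r ◂ g) (suc u)    with v , a ← neighbour r g u = suc v , a

no-isolated : (g : Code (2 + n)) → ∀ u → ∃[ v ] Adj g u v
no-isolated (r ◂ g) = neighbour r g

connected : (g : Code n) → ∀ u v → Star (Adj g) u v
connected •               zero    zero    = ε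
connected (r ◂ g)         zero    zero    = ε
connected (r@(w ∷ _) ◂ g) zero    (suc v) = here refl ◅ gmap suc id (connected g w v)
connected (r@(w ∷ _) ◂ g) (suc u) zero    = gmap suc id (connected g u w) ◅◅ here refl ◅ ε
connected (r ◂ g)         (suc u) (suc v) = gmap suc id (connected g u v)

toGraph : Code (2 + n) → Graph
toGraph {n} g = record
  { order       = 2 + n
  ; Adj         = Adj g
  ; adj?        = adj? g
  ; adj-sym     = adj-sym g
  ; adj-irrefl  = adj-irrefl g
  ; non-null    = _
  ; no-isolated = no-isolated g
  }

-- Degrees and edge sums by recursion on codes

deg : Code n → Fin n → ℕ
deg g u = sum λ v → if does (adj? g u v) then 1 else 0

degree≡deg : (g : Code (2 + n)) → ∀ u → Graph.degree (toGraph g) u ≡ deg g u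
degree≡deg {n} g u = begin
  List.length (filter (adj? g u) (allFin _))            ≡⟨ length≡sum (filter (adj? g u) (allFin _)) ⟩
  sumᴸ (map (λ _ → 1) (filter (adj? g u) (allFin _)))   ≡⟨ sum-filter (adj? g u) (λ _ → 1) (allFin _) ⟩
  sumᴸ (map (λ v → if does (adj? g u v) then 1 else 0) (allFin _)) ≡⟨ sum-allFin (λ v → if does (adj? g u v) then 1 else 0) ⟩
  deg g u ∎
  where open ≡-Reasoning

rowSum : List⁺ (Fin n) → (Fin n → ℕ) → ℕ
rowSum r h = sum λ v → if does (v ∈⁺? r) then h v else 0

edgeSum : Code n → (Fin n → Fin n → ℕ) → ℕ
edgeSum •       h = 0
edgeSum (r ◂ g) h = rowSum r (λ v → h zero (suc v)) + edgeSum g (λ u v → h (suc u) (suc v))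

edgeSum-cong : (g : Code n) {h k : Fin n → Fin n → ℕ} →
               (∀ u v → h u v ≡ k u v) → edgeSum g h ≡ edgeSum g k
edgeSum-cong •       h≗k = refl
edgeSum-cong (r ◂ g) h≗k = cong₂ _+_
  (sum-cong-≗ λ v → cong (if does (v ∈⁺? r) then_else 0) (h≗k zero (suc v)))
  (edgeSum-cong g λ u v → h≗k (suc u) (suc v))

-- In row and column `zero` only the entries (`zero`, `suc v`) pass the test u < v. What remains is
-- the matrix of `g`, so each step holds by computation.
sum-upper : (g : Code n) (h : Fin n → Fin n → ℕ) →
  sum (λ u → sum λ v → if does (u Fin.<? v) ∧ does (adj? g u v) then h u v else 0) ≡ edgeSum g h
sum-upper •       h = refl
sum-upper (r ◂ g) h = cong (rowSum r (λ v → h zero (suc v)) +_) (sum-upper g λ u v → h (suc u) (suc v))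

sum-edges : (g : Code (2 + n)) (h : Fin (2 + n) → Fin (2 + n) → ℕ) →
  sumᴸ (map (λ (u , v) → h u v) (Graph.edges (toGraph g))) ≡ edgeSum g h
sum-edges {n} g h = begin
  sumᴸ (map h′ (filter isEdge? (cartesianProduct (allFin _) (allFin _))))
    ≡⟨ sum-filter isEdge? h′ (cartesianProduct (allFin _) (allFin _)) ⟩
  sumᴸ (map (λ (u , v) → entry u v) (cartesianProduct (allFin _) (allFin _)))
    ≡⟨ sum-cartesianProduct (λ (u , v) → entry u v) (allFin _) (allFin _) ⟩
  sumᴸ (map (λ u → sumᴸ (map (entry u) (allFin _))) (allFin _))
    ≡⟨ sum-allFin (λ u → sumᴸ (map (entry u) (allFin _))) ⟩
  sum (λ u → sumᴸ (map (entry u) (allFin _)))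
    ≡⟨ sum-cong-≗ (λ u → sum-allFin (entry u)) ⟩
  sum (λ u → sum (entry u))
    ≡⟨ sum-upper g h ⟩
  edgeSum g h ∎
  where
  open ≡-Reasoning
  open Graph (toGraph g) using (isEdge?)
  h′ : Fin (2 + n) × Fin (2 + n) → ℕ
  h′ (u , v) = h u v
  entry : Fin (2 + n) → Fin (2 + n) → ℕ
  entry u v = if does (u Fin.<? v) ∧ does (adj? g u v) then h u v else 0

-- Graph invariants from a known degree function

record Counterexample (G : Graph) : Set where
  constructor counterexample
  open Graph G
  field
    isConnected : Connected
    δ≡2         : δ ≡ 2
    Δ≡5         : Δ ≡ 5
    M₁/n>M₂/m   : M₁/n > M₂/m

properties : {G : Graph} → Counterexample G → let open Graph G in
             Connected × δ ≡ 2 × Δ ≡ 5 × M₁/n > M₂/m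
properties (counterexample connected δ≡2 Δ≡5 M₁/n>M₂/m) = connected , δ≡2 , Δ≡5 , M₁/n>M₂/m

module _ (g : Code (2 + n)) {d : Fin (2 + n) → ℕ} (deg≗d : deg g ≗ d) where
  open Graph (toGraph g) using (degree; vertices; edges; size; size-nonZero; δ; Δ; M₁; M₂; M₁/n; M₂/m)

  private
    degree≗d : degree ≗ d
    degree≗d u = trans (degree≡deg g u) (deg≗d u)

  size≡ : size ≡ edgeSum g (λ _ _ → 1)
  size≡ = trans (length≡sum edges) (sum-edges g λ _ _ → 1)

  M₁≡ : M₁ ≡ sum (λ v → d v ^ 2)
  M₁≡ = trans (sum-allFin λ v → degree v ^ 2) (sum-cong-≗ λ v → cong (_^ 2) (degree≗d v))

  M₂≡ : M₂ ≡ edgeSum g (λ u v → d u * d v)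
  M₂≡ = trans (sum-edges g λ u v → degree u * degree v)
              (edgeSum-cong g λ u v → cong₂ _*_ (degree≗d u) (degree≗d v))

  δ≡ : ∀ {a} → a ≤ 2 + n → (∀ v → a ≤ d v) → ∀ v → d v ≡ a → δ ≡ a
  δ≡ {a} a≤n a≤d v dv≡a = min-allFin degree a≤n
    (λ u → subst (a ≤_) (sym (degree≗d u)) (a≤d u)) v (trans (degree≗d v) dv≡a)

  Δ≡ : ∀ {b} → (∀ v → d v ≤ b) → ∀ v → d v ≡ b → Δ ≡ b
  Δ≡ {b} d≤b v dv≡b = max-allFin degree
    (λ u → subst (_≤ b) (sym (degree≗d u)) (d≤b u)) v (trans (degree≗d v) dv≡b)

  zagreb-> : ∀ {a b c} → sum (λ v → d v ^ 2) ≡ a → edgeSum g (λ u v → d u * d v) ≡ b →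
             edgeSum g (λ _ _ → 1) ≡ c → b * (2 + n) < a * c → M₁/n > M₂/m
  zagreb-> {a} {b} {c} refl refl refl bn<ac = /-mono-< M₂ size M₁ (2 + n) {{size-nonZero}}
    (subst₂ (λ x y → x * (2 + n) < y) (sym M₂≡) (sym (cong₂ _*_ M₁≡ size≡)) bn<ac)

  toCounterexample : ∀ {a b c} → (∀ v → 2 ≤ d v × d v ≤ 5) → ∃[ v ] d v ≡ 2 → ∃[ v ] d v ≡ 5 →
    sum (λ v → d v ^ 2) ≡ a → edgeSum g (λ u v → d u * d v) ≡ b → edgeSum g (λ _ _ → 1) ≡ c →
    b * (2 + n) < a * c → Counterexample (toGraph g)
  toCounterexample bounds (u , du≡2) (v , dv≡5) a≡ b≡ c≡ bn<ac = counterexample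
    (connected g)
    (δ≡ (s≤s (s≤s z≤n)) (proj₁ ∘ bounds) u du≡2)
    (Δ≡ (proj₂ ∘ bounds) v dv≡5)
    (zagreb-> a≡ b≡ c≡ bn<ac)

-- The base graph and the chains of diamonds

path : ∀ n → Code (suc n)
path zero    = •
path (suc n) = [ zero ] ◂ path n

-- The vertices in even position of path 20 are the 11 future vertices of
-- degree 5; they lack 4, 3, …, 3, 4 neighbours. The values hub 0, …, hub 33 hit
-- position 0 four times and the others three times; they are handed out two to
-- each vertex added by subdivisions 17. The place left at position 20 goes to
-- the vertex zero of base, which thus has degree 1.
hub : ℕ → Fin 21
hub s = (2 * (s % 11)) mod 21

subdivisions : ∀ j → Code (j + 21)
subdivisions zero    = path 20
-- Consecutive numbers differ modulo 11, so the two listed vertices are distinct and the new vertex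
-- has degree 2.
subdivisions (suc j) = ((j ↑ʳ hub (2 * j)) ∷ (j ↑ʳ hub (suc (2 * j))) ∷ []) ◂ subdivisions j

base : Code 39
base = [ 17 ↑ʳ (# 20) ] ◂ subdivisions 17

-- The new vertices span K₄ minus the edge between `0F` and `3F`. Here `3F` is joined to the old
-- vertex zero, and `0F` has degree 2 until the next diamond is attached to it.
diamond : Code (suc n) → Code (5 + n)
diamond g = (0F ∷ 1F ∷ []) ◂ (0F ∷ 1F ∷ []) ◂ [ 0F ] ◂ [ 0F ] ◂ g

chain : ∀ k → Code (suc (k * 4 + 38))
chain zero    = base
chain (suc k) = diamond (chain k)

-- Degrees and sums along a chain

edgeSum-diamond : (g : Code (suc n)) (h : Fin (5 + n) → Fin (5 + n) → ℕ) →
  edgeSum (diamond g) h ≡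
    h 0F 1F + h 0F 2F + h 1F 2F + h 1F 3F + h 2F 3F + h 3F (4 ↑ʳ 0F)
    + edgeSum g (λ u v → h (4 ↑ʳ u) (4 ↑ʳ v))
-- The rows of the new vertices vanish past the vertex zero of `g`, leaving five edges of the
-- diamond and the link to `g`.
edgeSum-diamond {n} g h rewrite sum-replicate-zero n =
  reassociate (h 0F 1F) (h 0F 2F) (h 1F 2F) (h 1F 3F) (h 2F 3F) (h 3F (4 ↑ʳ 0F)) _
  where
  reassociate : ∀ a b c d e f x →
    a + (b + 0) + (c + (d + 0) + (e + 0 + (f + 0 + x))) ≡ a + b + c + d + e + f + x
  reassociate = solve-∀

-- The degree after one more diamond is attached at vertex zero.
completedDeg : Code (suc n) → Fin (suc n) → ℕ
completedDeg g v = deg g v + (if does (v ∈⁺? [ zero ]) then 1 else 0)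

-- These completed degrees no longer change as the chain grows, which suits induction; the actual
-- degrees, `outer`, differ from them only at the free end.
inner : ∀ k → Fin (suc (k * 4 + 38)) → ℕ
inner zero    v                         = completedDeg base v
inner (suc k) 0F                        = 3
inner (suc k) 1F                        = 3
inner (suc k) 2F                        = 3
inner (suc k) 3F                        = 3
inner (suc k) (suc (suc (suc (suc v)))) = inner k v

outer : ∀ k → Fin (suc (suc k * 4 + 38)) → ℕ
outer k 0F      = 2
outer k (suc v) = inner (suc k) (suc v)

deg-diamond : (g : Code (suc n)) → ∀ v → deg (diamond g) (4 ↑ʳ v) ≡ completedDeg g v
deg-diamond g v = +-comm (if does (v ∈⁺? [ zero ]) then 1 else 0) (deg g v)

-- Mutual induction: a new diamond turns completed degrees of `chain k` into degrees of
-- `chain (suc k)`, and completing those raises the 2 at vertex zero to 3.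
completedDeg-chain : ∀ k v → completedDeg (chain k) v ≡ inner k v
deg-chain : ∀ k v → deg (chain (suc k)) v ≡ outer k v

completedDeg-chain zero    v       = refl
completedDeg-chain (suc k) 0F      = cong (_+ 1) (deg-chain k 0F)
completedDeg-chain (suc k) (suc v) = trans (+-identityʳ _) (deg-chain k (suc v))

deg-chain k 0F rewrite sum-replicate-zero (k * 4 + 38) = refl
deg-chain k 1F rewrite sum-replicate-zero (k * 4 + 38) = refl
deg-chain k 2F rewrite sum-replicate-zero (k * 4 + 38) = refl
deg-chain k 3F rewrite sum-replicate-zero (k * 4 + 38) = refl
deg-chain k (suc (suc (suc (suc v)))) = trans (deg-diamond (chain k) v) (completedDeg-chain k v)

2≤inner≤5 : ∀ k v → 2 ≤ inner k v × inner k v ≤ 5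
2≤inner≤5 zero    v  = from-yes (Fin.all? λ v → (2 ≤? inner 0 v) ×-dec (inner 0 v ≤? 5)) v
2≤inner≤5 (suc k) 0F = from-yes ((2 ≤? 3) ×-dec (3 ≤? 5))
2≤inner≤5 (suc k) 1F = from-yes ((2 ≤? 3) ×-dec (3 ≤? 5))
2≤inner≤5 (suc k) 2F = from-yes ((2 ≤? 3) ×-dec (3 ≤? 5))
2≤inner≤5 (suc k) 3F = from-yes ((2 ≤? 3) ×-dec (3 ≤? 5))
2≤inner≤5 (suc k) (suc (suc (suc (suc v)))) = 2≤inner≤5 k v

2≤outer≤5 : ∀ k v → 2 ≤ outer k v × outer k v ≤ 5
2≤outer≤5 k 0F      = from-yes ((2 ≤? 2) ×-dec (2 ≤? 5))
2≤outer≤5 k (suc v) = 2≤inner≤5 (suc k) (suc v)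

inner-attains-5 : ∀ k → ∃[ v ] inner k v ≡ 5
-- Position 0 of `path 20`, after the vertex zero of `base` and the 17 subdivision vertices.
inner-attains-5 zero    = # 18 , refl
inner-attains-5 (suc k) with v , eq ← inner-attains-5 k = 4 ↑ʳ v , eq

outer-attains-5 : ∀ k → ∃[ v ] outer k v ≡ 5
outer-attains-5 k with v , eq ← inner-attains-5 k = 4 ↑ʳ v , eq

edgeCount-chain : ∀ k → edgeSum (chain k) (λ _ _ → 1) ≡ 55 + k * 6
edgeCount-chain zero    = refl
edgeCount-chain (suc k) = begin
  edgeSum (diamond (chain k)) (λ _ _ → 1)  ≡⟨ edgeSum-diamond (chain k) (λ _ _ → 1) ⟩
  6 + edgeSum (chain k) (λ _ _ → 1)        ≡⟨ cong (6 +_) (edgeCount-chain k) ⟩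
  6 + (55 + k * 6)                         ≡⟨⟩
  55 + suc k * 6                           ∎
  where open ≡-Reasoning

sum-inner² : ∀ k → sum (λ v → inner k v ^ 2) ≡ 387 + k * 36
-- 387 = 11 · 25 + 28 · 4, the completed vertex zero having degree 2.
sum-inner² zero    = refl
sum-inner² (suc k) = cong (36 +_) (sum-inner² k)

sum-outer² : ∀ k → sum (λ v → outer k v ^ 2) ≡ 418 + k * 36
sum-outer² k = cong (31 +_) (sum-inner² k)

edgeSum-inner : ∀ k → edgeSum (chain (suc k)) (λ u v → inner (suc k) u * inner (suc k) v) ≡ 601 + k * 54
-- 601 = 55 · 10 + 5 · 9 + 6: the first link joins degrees 2 and 3. Every later link joins two
-- vertices of degree 3.
edgeSum-inner zero    = edgeSum-diamond base (λ u v → inner 1 u * inner 1 v)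
edgeSum-inner (suc k) = trans
  (edgeSum-diamond (chain (suc k)) (λ u v → inner (2 + k) u * inner (2 + k) v))
  (cong (λ x → 54 + x) (edgeSum-inner k))

edgeSum-outer : ∀ k → edgeSum (chain (2 + k)) (λ u v → outer (suc k) u * outer (suc k) v) ≡ 649 + k * 54
edgeSum-outer k = trans
  (edgeSum-diamond (chain (suc k)) (λ u v → outer (suc k) u * outer (suc k) v))
  -- 48 = 2 · 6 + 4 · 9, as the two edges at the free end join degrees 2 and 3.
  (cong (48 +_) (edgeSum-inner k))

-- The inequality and the infinite family

cross-multiplied : ∀ k → 43 ≤ k → (649 + k * 54) * suc ((2 + k) * 4 + 38) < (418 + suc k * 36) * (55 + (2 + k) * 6)
-- With `2 + k` diamonds the right side exceeds the left by 2k - 85, and 2 · 43 = 86.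
cross-multiplied k 43≤k = +-cancelʳ-< 85 _ _
  (<-≤-trans (+-monoʳ-< _ (*-monoʳ-≤ 2 43≤k)) (≤-reflexive (identity k)))
  where
  identity : ∀ k → (649 + k * 54) * suc ((2 + k) * 4 + 38) + 2 * k ≡ (418 + suc k * 36) * (55 + (2 + k) * 6) + 85
  identity = solve-∀

-- Opaque (and Counterexample is a record), since otherwise δ and Δ of a chain
-- unfold to a minimum and a maximum of dozens of terms whenever types are compared.
opaque
  chainGraph : ℕ → Graph
  chainGraph k = toGraph {3 + (suc k * 4 + 38)} (chain (2 + k))

  -- Isomorphic graphs have equal orders, and the order 39 + 4(2 + k) determines k.
  chainGraph-injective : ∀ k l → chainGraph k ≅ chainGraph l → k ≡ l
  chainGraph-injective k l iso = +-cancelˡ-≡ 2 k l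
    (*-cancelʳ-≡ (2 + k) (2 + l) 4
      (+-cancelʳ-≡ 38 ((2 + k) * 4) ((2 + l) * 4)
        (suc-injective (Perm.↔⇒≡ (_≅_.bijection iso)))))

  counterexample-chain : ∀ k → 43 ≤ k → Counterexample (chainGraph k)
  counterexample-chain k 43≤k = toCounterexample {3 + (suc k * 4 + 38)} (chain (2 + k)) (deg-chain (suc k))
    (2≤outer≤5 (suc k)) (0F , refl) (outer-attains-5 (suc k))
    (sum-outer² (suc k)) (edgeSum-outer k) (edgeCount-chain (2 + k)) (cross-multiplied k 43≤k)

proposition2p4 : InfinitelyMany λ G → let open Graph G in
    Connected × δ ≡ 2 × Δ ≡ 5 × M₁/n > M₂/m
proposition2p4 =
    (λ i → chainGraph (43 + i))
  , (λ i → properties (counterexample-chain (43 + i) (m≤m+n 43 i)))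
  , (λ i j iso → +-cancelˡ-≡ 43 i j (chainGraph-injective (43 + i) (43 + j) iso))
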